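{- Let $T$ be a tree of order $n$. Then $$\sigma_1(T)+\sigma_1(\overline{T})\ \ge\ (n-1)^2,$$ with equality if and only if $T\cong K_{1,n-1}$.
   Context: All graphs are finite, simple and undirected, with nonempty vertex set; the order of a graph is its number of vertices. $\overline{T}$ denotes the complement of $T$ (same vertex set, two distinct vertices being adjacent in $\overline{T}$ iff they are not adjacent in $T$). $K_{1,n-1}$ is the star on $n$ vertices, i.e. the complete bipartite graph with partite sets of sizes $1$ and $n-1$ (for $n=1$ it is the single-vertex graph). A subset $S\subseteq V(G)$ of the vertices of a graph $G$ is called a $1$-nearly independent vertex subset of $G$ if the subgraph of $G$ induced by $S$ contains exactly one edge; $\sigma_1(G)$ denotes the number of $1$-nearly independent vertex subsets of $G$. -}

module Defs where

open import Data.Fin using (Fin; splitAt; _≟_; _<?_)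
open import Data.Fin.Subset using (Subset; inside; outside; _∈_)
open import Data.Fin.Subset.Properties using (_∈?_)
open import Data.List using (List; _∷_; [_]; _++_; _∷ʳ_; map; filter; length; allFin; cartesianProduct)
open import Data.List.Relation.Unary.Linked using (Linked)
open import Data.List.Relation.Unary.Unique.Propositional using (Unique)
open import Data.Nat using (ℕ; zero; suc; _+_; _≤_)
import Data.Nat as ℕ
open import Data.Product using (Σ; _×_; _,_)
open import Data.Sum using (_⊎_; inj₁; inj₂)
import Data.Vec as Vec
open import Function using (_↔_; _⇔_; Inverse)
open import Level using (0ℓ)
open import Relation.Binary.Core using (Rel)
open import Relation.Binary.Definitions using (Symmetric; Irreflexive; Decidable)
open import Relation.Binary.Construct.Closure.ReflexiveTransitive using (Star)
open import Relation.Binary.PropositionalEquality using (_≡_; _≢_; refl; sym)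
open import Relation.Nullary using (¬_; yes; no)
open import Relation.Nullary.Decidable using (¬?; _×-dec_)
import Relation.Unary as Unary

-- Simple graphs of order n, with vertex set Fin n.
record Graph (n : ℕ) : Set₁ where
  field
    Adj    : Rel (Fin n) 0ℓ
    adj?   : Decidable Adj
    symm   : Symmetric Adj
    irrefl : Irreflexive _≡_ Adj

open Graph public

infix 4 _≅_

_≅_ : ∀ {m n} → Graph m → Graph n → Set
_≅_ {m} {n} G H =
  Σ (Fin m ↔ Fin n) λ f →
    ∀ i j → Adj G i j ⇔ Adj H (Inverse.to f i) (Inverse.to f j)

complement : ∀ {n} → Graph n → Graph n
complement G = record
  { Adj    = λ i j → i ≢ j × ¬ Adj G i j
  ; adj?   = λ i j → ¬? (i ≟ j) ×-dec ¬? (adj? G i j)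
  ; symm   = λ (i≢j , ¬ij) → (λ j≡i → i≢j (sym j≡i)) , (λ ji → ¬ij (symm G ji))
  ; irrefl = λ i≡j (i≢j , _) → i≢j i≡j
  }

data Opposite {A B : Set} : Rel (A ⊎ B) 0ℓ where
  left-right : ∀ {a b} → Opposite (inj₁ a) (inj₂ b)
  right-left : ∀ {a b} → Opposite (inj₂ b) (inj₁ a)

-- The complete bipartite graph whose parts are the first p and the last q
-- elements of Fin (p + q).
K : ∀ p q → Graph (p + q)
K p q = record
  { Adj    = λ i j → Opposite (splitAt p i) (splitAt p j)
  ; adj?   = λ i j → opposite? (splitAt p i) (splitAt p j)
  ; symm   = opposite-sym
  ; irrefl = λ { {i} refl → opposite-irrefl (splitAt p i) }
  }
  where
  opposite? : Decidable (Opposite {Fin p} {Fin q})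
  opposite? (inj₁ _) (inj₁ _) = no λ ()
  opposite? (inj₁ _) (inj₂ _) = yes left-right
  opposite? (inj₂ _) (inj₁ _) = yes right-left
  opposite? (inj₂ _) (inj₂ _) = no λ ()

  opposite-sym : Symmetric (Opposite {Fin p} {Fin q})
  opposite-sym left-right = right-left
  opposite-sym right-left = left-right

  opposite-irrefl : ∀ (x : Fin p ⊎ Fin q) → ¬ Opposite x x
  opposite-irrefl (inj₁ _) ()
  opposite-irrefl (inj₂ _) ()

Connected : ∀ {n} → Graph n → Set
Connected G = ∀ i j → Star (Adj G) i j

-- The cycle x, x₁, …, xₖ, x, where xs = x₁, …, xₖ; its length k + 1 is at
-- least 3.
record IsCycle {n} (G : Graph n) (x : Fin n) (xs : List (Fin n)) : Set where
  field
    long     : 2 ≤ length xs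
    distinct : Unique (x ∷ xs)
    closed   : Linked (Adj G) (x ∷ xs ∷ʳ x)

Acyclic : ∀ {n} → Graph n → Set
Acyclic G = ∀ x xs → ¬ IsCycle G x xs

record IsTree {n} (G : Graph n) : Set where
  field
    connected : Connected G
    acyclic   : Acyclic G

-- The edges of the subgraph induced by S, each unordered edge {i , j} being
-- listed once, as the pair (i , j) with i < j.
inducedEdges : ∀ {n} → Graph n → Subset n → List (Fin n × Fin n)
inducedEdges {n} G S =
  filter (λ (i , j) → (i <? j) ×-dec (i ∈? S) ×-dec (j ∈? S) ×-dec adj? G i j)
         (cartesianProduct (allFin n) (allFin n))

OneNearlyIndependent : ∀ {n} → Graph n → Subset n → Set
OneNearlyIndependent G S = length (inducedEdges G S) ≡ 1

oneNearlyIndependent? : ∀ {n} (G : Graph n) → Unary.Decidable (OneNearlyIndependent G)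
oneNearlyIndependent? G S = length (inducedEdges G S) ℕ.≟ 1

-- Every subset of Fin n, listed exactly once.
allSubsets : ∀ n → List (Subset n)
allSubsets zero    = [ Vec.[] ]
allSubsets (suc n) =
  map (outside Vec.∷_) (allSubsets n) ++ map (inside Vec.∷_) (allSubsets n)

σ₁ : ∀ {n} → Graph n → ℕ
σ₁ {n} G = length (filter (oneNearlyIndependent? G) (allSubsets n))

{-# OPTIONS --safe #-}

-- Write e(S) and ē(S) for the numbers of edges induced by S in T and in its
-- complement, so that e(S) + ē(S) = |S| C 2.  A pair contributes 1 to
-- σ₁(T) + σ₁(T̄), and a triple contributes 1 when 1 ≤ e(S) ≤ 2, hence always at
-- least e(S) / 2, because T has no triangle.  Each edge lies in n − 2 triples
-- and T is connected, so the sum is at least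
-- n C 2 + (n − 1)(n − 2) / 2 = (n − 1)².  Equality excludes triples with
-- exactly one edge; then every vertex is adjacent to an end of any given edge,
-- and without triangles and 4-cycles this forces a star.  Conversely, in a star
-- e(S) ∈ {0 , |S| − 1}, and every estimate is an equality.

module Submission where

open import Defs
open import Algebra.Properties.Semiring.Sum using ()
open import Data.Bool using (Bool; true; false; not; _∧_)
open import Data.Bool.Properties using (∧-zeroʳ)
open import Data.Fin using (Fin; zero; suc; _≟_; _<?_)
open import Data.Fin.Permutation using (transpose)
open import Data.Fin.Properties using (suc-injective; all?; ¬∀⟶∃¬)
open import Data.Fin.Subset using (Subset; inside; outside; ∣_∣; ⊤; ⊥; ⁅_⁆)
open import Data.Fin.Subset.Properties using (_∈?_; ∣p∣≡n⇒p≡⊤; ∣⊤∣≡n; ∣⊥∣≡0; ∣⁅x⁆∣≡1)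
open import Data.List using ([]; _∷_; _++_; map; filter; length; tabulate; cartesianProduct)
open import Data.List.Properties using (length-++; filter-++; map-tabulate)
open import Data.List.Relation.Unary.All using ([]; _∷_)
open import Data.List.Relation.Unary.AllPairs using ([]; _∷_)
open import Data.List.Relation.Unary.Linked using ([-]; _∷_)
open import Data.Nat using (ℕ; zero; suc; NonZero; _+_; _*_; _∸_; _^_; _≤_; _<_; _≥_; z≤n; s≤s; _≡ᵇ_)
open import Data.Nat.Combinatorics using (_C_; nCn≡1; nC1≡n; nCk≡nC[n∸k]; nCk+nC[k+1]≡[n+1]C[k+1])
open import Data.Nat.Properties hiding (_≟_; _<?_; suc-injective)
open import Data.Nat.Tactic.RingSolver using (solve-∀)
open import Data.Product using (_×_; _,_; ∃-syntax; proj₁)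
open import Data.Sum using (_⊎_; inj₁; inj₂)
open import Data.Vec using (lookup; _[_]≔_)
import Data.Vec as Vec
open import Data.Vec.Properties using (lookup-replicate; lookup∘update; lookup∘update′; []≔-idempotent; []≔-lookup)
open import Function using (_⇔_; _∘_; mk⇔; Equivalence; Inverse)
open import Relation.Binary.Construct.Closure.ReflexiveTransitive using (Star; ε; _◅_)
open import Relation.Binary.PropositionalEquality using (_≡_; _≢_; refl; sym; trans; cong; cong₂; subst; module ≡-Reasoning)
open import Relation.Nullary using (¬_; Dec; does; yes; no; contradiction)
open import Relation.Nullary.Decidable using (dec-true; dec-false; _×-dec_; _⊎-dec_; decidable-stable; does-⇔)
import Relation.Unary as Unary

open Algebra.Properties.Semiring.Sum +-*-semiring
  using (sum; sum-cong-≗; ∑-distrib-+; sum-replicate-zero; *-distribˡ-sum; *-distribʳ-sum)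

-- Lengths of filtered lists as sums of indicators.

𝟙 : Bool → ℕ
𝟙 true  = 1
𝟙 false = 0

*-distribˡ-∑∑ : ∀ {m n} c (f : Fin m → Fin n → ℕ) →
  c * sum (λ i → sum (f i)) ≡ sum (λ i → sum (λ j → c * f i j))
*-distribˡ-∑∑ c f = trans (*-distribˡ-sum c (λ i → sum (f i))) (sum-cong-≗ (λ i → *-distribˡ-sum c (f i)))

*-distribʳ-∑∑ : ∀ {m n} c (f : Fin m → Fin n → ℕ) →
  sum (λ i → sum (f i)) * c ≡ sum (λ i → sum (λ j → f i j * c))
*-distribʳ-∑∑ c f = trans (*-distribʳ-sum c (λ i → sum (f i))) (sum-cong-≗ (λ i → *-distribʳ-sum c (f i)))

length-filter-∷ : ∀ {A : Set} {P : A → Set} (P? : Unary.Decidable P) x xs →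
  length (filter P? (x ∷ xs)) ≡ 𝟙 (does (P? x)) + length (filter P? xs)
length-filter-∷ P? x xs with does (P? x)
... | true  = refl
... | false = refl

length-filter-++ : ∀ {A : Set} {P : A → Set} (P? : Unary.Decidable P) xs ys →
  length (filter P? (xs ++ ys)) ≡ length (filter P? xs) + length (filter P? ys)
length-filter-++ P? xs ys = trans (cong length (filter-++ P? xs ys)) (length-++ (filter P? xs))

length-filter-map : ∀ {A B : Set} {P : B → Set} (P? : Unary.Decidable P) (f : A → B) xs →
  length (filter P? (map f xs)) ≡ length (filter (P? ∘ f) xs)
length-filter-map P? f []       = refl
length-filter-map P? f (x ∷ xs) with does (P? (f x))
... | true  = cong suc (length-filter-map P? f xs)
... | false = length-filter-map P? f xs

length-filter-tabulate : ∀ {n} {A : Set} {P : A → Set} (P? : Unary.Decidable P) (f : Fin n → A) →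
  length (filter P? (tabulate f)) ≡ sum (λ i → 𝟙 (does (P? (f i))))
length-filter-tabulate {zero}  P? f = refl
length-filter-tabulate {suc n} P? f =
  trans (length-filter-∷ P? (f zero) _) (cong (_ +_) (length-filter-tabulate P? (f ∘ suc)))

length-filter-cartesianProduct : ∀ {m n} {A B : Set} {P : A × B → Set} (P? : Unary.Decidable P)
  (f : Fin m → A) (g : Fin n → B) →
  length (filter P? (cartesianProduct (tabulate f) (tabulate g)))
    ≡ sum (λ i → sum (λ j → 𝟙 (does (P? (f i , g j)))))
length-filter-cartesianProduct {zero}  P? f g = refl
length-filter-cartesianProduct {suc m} P? f g =
  trans (length-filter-++ P? (map (f zero ,_) (tabulate g)) _)
    (cong₂ _+_
      (trans (cong (length ∘ filter P?) (map-tabulate g (f zero ,_)))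
             (length-filter-tabulate P? (λ j → f zero , g j)))
      (length-filter-cartesianProduct P? (f ∘ suc) g))

does-∈? : ∀ {n} (i : Fin n) S → does (i ∈? S) ≡ lookup S i
does-∈? zero    (true  Vec.∷ S) = refl
does-∈? zero    (false Vec.∷ S) = refl
does-∈? (suc i) (_ Vec.∷ S)     = does-∈? i S

-- Edge counts of induced subgraphs.

BoolRel : ℕ → Set
BoolRel n = Fin n → Fin n → Bool

-- Taken over a bare Boolean relation, so that induction on the vertex set can drop the first vertex
-- by `restrict` without rebuilding a graph.
edgesIn : ∀ {n} → BoolRel n → Subset n → ℕ
edgesIn a S = sum (λ i → sum (λ j → 𝟙 (does (i <? j) ∧ lookup S i ∧ lookup S j ∧ a i j)))

degreeIn : ∀ {n} → BoolRel n → Subset n → Fin n → ℕ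
degreeIn a S v = sum (λ j → 𝟙 (lookup S j ∧ a v j))

adjᵇ : ∀ {n} → Graph n → BoolRel n
adjᵇ G i j = does (adj? G i j)

length-inducedEdges : ∀ {n} (G : Graph n) S → length (inducedEdges G S) ≡ edgesIn (adjᵇ G) S
length-inducedEdges G S =
  trans (length-filter-cartesianProduct
          (λ (i , j) → (i <? j) ×-dec (i ∈? S) ×-dec (j ∈? S) ×-dec adj? G i j) (λ i → i) (λ j → j))
    (sum-cong-≗ (λ i → sum-cong-≗ (λ j →
      cong₂ (λ p q → 𝟙 (does (i <? j) ∧ p ∧ q ∧ adjᵇ G i j)) (does-∈? i S) (does-∈? j S))))

sum-lookup : ∀ {n} (S : Subset n) → sum (𝟙 ∘ lookup S) ≡ ∣ S ∣
sum-lookup Vec.[]            = refl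
sum-lookup (true  Vec.∷ S) = cong suc (sum-lookup S)
sum-lookup (false Vec.∷ S) = sum-lookup S

size-insert : ∀ {n} (S : Subset n) v → lookup S v ≡ outside → ∣ S [ v ]≔ inside ∣ ≡ suc ∣ S ∣
size-insert (false Vec.∷ S) zero    refl = refl
size-insert (true  Vec.∷ S) (suc v) v∉S = cong suc (size-insert S v v∉S)
size-insert (false Vec.∷ S) (suc v) v∉S = size-insert S v v∉S

sum-lookup-insert : ∀ {n} (S : Subset n) v (p : Fin n → Bool) → lookup S v ≡ outside →
  sum (λ j → 𝟙 (lookup (S [ v ]≔ inside) j ∧ p j)) ≡ sum (λ j → 𝟙 (lookup S j ∧ p j)) + 𝟙 (p v)
sum-lookup-insert (false Vec.∷ S) zero    p refl = +-comm (𝟙 (p zero)) _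
sum-lookup-insert (b Vec.∷ S)     (suc v) p v∉S  =
  trans (cong (𝟙 (b ∧ p zero) +_) (sum-lookup-insert S v (p ∘ suc) v∉S))
        (sym (+-assoc (𝟙 (b ∧ p zero)) _ _))

restrict : ∀ {n} → BoolRel (suc n) → BoolRel n
restrict a i j = a (suc i) (suc j)

-- The new edges are those between `v` and `S`. `edgesIn` reads a pair from its smaller end and
-- `degreeIn` reads it from `v`, so symmetry is needed for the elements of `S` below `v`.
edgesIn-insert : ∀ {n} (a : BoolRel n) → (∀ i j → a i j ≡ a j i) →
  ∀ (S : Subset n) v → lookup S v ≡ outside →
  edgesIn a (S [ v ]≔ inside) ≡ edgesIn a S + degreeIn a S v
edgesIn-insert {suc n} a a-sym (false Vec.∷ S) zero refl =
  -- Vertex `zero` is the smaller end of all its pairs, so its row is its degree; when it is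
  -- outside, its row is a sum of zeros still to be removed.
  trans (+-comm (degreeIn a (false Vec.∷ S) zero) (edgesIn (restrict a) S))
        (cong (λ z → z + edgesIn (restrict a) S + degreeIn a (false Vec.∷ S) zero) (sym (sum-replicate-zero n)))
edgesIn-insert {suc n} a a-sym (b Vec.∷ S) (suc v) v∉S = begin
  row b (S [ v ]≔ inside) + edgesIn a′ (S [ v ]≔ inside)
    ≡⟨ cong₂ _+_ (row-insert b) (edgesIn-insert a′ (λ i j → a-sym (suc i) (suc j)) S v v∉S) ⟩
  row b S + 𝟙 (b ∧ a zero (suc v)) + (edgesIn a′ S + degreeIn a′ S v)
    ≡⟨ regroup (row b S) _ (edgesIn a′ S) _ ⟩
  row b S + edgesIn a′ S + (𝟙 (b ∧ a zero (suc v)) + degreeIn a′ S v)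
    ≡⟨ cong (λ z → row b S + edgesIn a′ S + (𝟙 (b ∧ z) + degreeIn a′ S v)) (a-sym zero (suc v)) ⟩
  row b S + edgesIn a′ S + (𝟙 (b ∧ a (suc v) zero) + degreeIn a′ S v) ∎
  where
  open ≡-Reasoning
  a′ = restrict a
  row : Bool → Subset n → ℕ
  row b S = sum (λ j → 𝟙 (b ∧ lookup S j ∧ a zero (suc j)))
  row-insert : ∀ b → row b (S [ v ]≔ inside) ≡ row b S + 𝟙 (b ∧ a zero (suc v))
  row-insert true  = sum-lookup-insert S v (λ j → a zero (suc j)) v∉S
  row-insert false = sym (+-identityʳ _)
  regroup : ∀ w x y z → w + x + (y + z) ≡ w + y + (x + z)
  regroup = solve-∀

nC0≡1 : ∀ n → n C 0 ≡ 1
nC0≡1 n = trans (nCk≡nC[n∸k] {0} {n} z≤n) (nCn≡1 n)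

pascal₂ : ∀ n → suc n C 2 ≡ n + n C 2
pascal₂ n = trans (sym (nCk+nC[k+1]≡[n+1]C[k+1] n 1)) (cong (_+ n C 2) (nC1≡n n))

-- If the first vertex is chosen, its pair with each other chosen vertex is counted by exactly one
-- of the two rows; this gives the summand `∣ S ∣` in Pascal's rule. Otherwise both rows vanish.
edgesIn-complement : ∀ {n} (a b : BoolRel n) → (∀ i j → i ≢ j → b i j ≡ not (a i j)) →
  ∀ S → edgesIn a S + edgesIn b S ≡ ∣ S ∣ C 2
edgesIn-complement a b b≡¬a Vec.[] = refl
edgesIn-complement {suc n} a b b≡¬a (s Vec.∷ S) = begin
  row a s + edgesIn a′ S + (row b s + edgesIn b′ S)
    ≡⟨ exchange (row a s) _ _ _ ⟩
  (row a s + row b s) + (edgesIn a′ S + edgesIn b′ S)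
    ≡⟨ cong ((row a s + row b s) +_)
         (edgesIn-complement a′ b′ (λ i j i≢j → b≡¬a (suc i) (suc j) (i≢j ∘ suc-injective)) S) ⟩
  (row a s + row b s) + ∣ S ∣ C 2
    ≡⟨ rows s ⟩
  ∣ s Vec.∷ S ∣ C 2 ∎
  where
  open ≡-Reasoning
  a′ = restrict a
  b′ = restrict b
  row : BoolRel (suc n) → Bool → ℕ
  row a s = sum (λ j → 𝟙 (s ∧ lookup S j ∧ a zero (suc j)))
  exchange : ∀ w x y z → w + x + (y + z) ≡ (w + y) + (x + z)
  exchange = solve-∀
  split : ∀ l p q → q ≡ not p → 𝟙 (l ∧ p) + 𝟙 (l ∧ q) ≡ 𝟙 l
  split false _     _ _    = refl
  split true  true  _ refl = refl
  split true  false _ refl = refl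
  rows : ∀ s → (row a s + row b s) + ∣ S ∣ C 2 ≡ ∣ s Vec.∷ S ∣ C 2
  rows false = cong (_+ ∣ S ∣ C 2) (cong₂ _+_ (sum-replicate-zero n) (sum-replicate-zero n))
  rows true  = begin
    row a true + row b true + ∣ S ∣ C 2
      ≡⟨ cong (_+ ∣ S ∣ C 2) (∑-distrib-+ (λ j → 𝟙 (lookup S j ∧ a zero (suc j))) _) ⟨
    sum (λ j → 𝟙 (lookup S j ∧ a zero (suc j)) + 𝟙 (lookup S j ∧ b zero (suc j))) + ∣ S ∣ C 2
      ≡⟨ cong (_+ ∣ S ∣ C 2) (trans (sum-cong-≗ (λ j → split (lookup S j) _ _ (b≡¬a zero (suc j) λ ()))) (sum-lookup S)) ⟩
    ∣ S ∣ + ∣ S ∣ C 2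
      ≡⟨ pascal₂ ∣ S ∣ ⟨
    suc ∣ S ∣ C 2 ∎

-- Sums over all subsets.

∑ₛ : ∀ {n} → (Subset n → ℕ) → ℕ
∑ₛ {zero}  g = g Vec.[]
∑ₛ {suc n} g = ∑ₛ (g ∘ (outside Vec.∷_)) + ∑ₛ (g ∘ (inside Vec.∷_))

∑ₛ-cong : ∀ {n} {f g : Subset n → ℕ} → (∀ S → f S ≡ g S) → ∑ₛ f ≡ ∑ₛ g
∑ₛ-cong {zero}  f≗g = f≗g Vec.[]
∑ₛ-cong {suc n} f≗g = cong₂ _+_ (∑ₛ-cong (f≗g ∘ (outside Vec.∷_))) (∑ₛ-cong (f≗g ∘ (inside Vec.∷_)))

∑ₛ-zero : ∀ {n} → ∑ₛ {n} (λ _ → 0) ≡ 0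
∑ₛ-zero {zero}  = refl
∑ₛ-zero {suc n} = cong₂ _+_ (∑ₛ-zero {n}) (∑ₛ-zero {n})

∑ₛ-distrib-+ : ∀ {n} (f g : Subset n → ℕ) → ∑ₛ (λ S → f S + g S) ≡ ∑ₛ f + ∑ₛ g
∑ₛ-distrib-+ {zero}  f g = refl
∑ₛ-distrib-+ {suc n} f g =
  trans (cong₂ _+_ (∑ₛ-distrib-+ (f ∘ (outside Vec.∷_)) (g ∘ (outside Vec.∷_)))
                   (∑ₛ-distrib-+ (f ∘ (inside Vec.∷_)) (g ∘ (inside Vec.∷_))))
        (exchange (∑ₛ (f ∘ (outside Vec.∷_))) _ _ _)
  where
  exchange : ∀ w x y z → w + x + (y + z) ≡ w + y + (x + z)
  exchange = solve-∀

∑ₛ-distribˡ-* : ∀ {n} c (f : Subset n → ℕ) → ∑ₛ (λ S → c * f S) ≡ c * ∑ₛ f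
∑ₛ-distribˡ-* {zero}  c f = refl
∑ₛ-distribˡ-* {suc n} c f =
  trans (cong₂ _+_ (∑ₛ-distribˡ-* c (f ∘ (outside Vec.∷_))) (∑ₛ-distribˡ-* c (f ∘ (inside Vec.∷_))))
        (sym (*-distribˡ-+ c (∑ₛ (f ∘ (outside Vec.∷_))) _))

∑ₛ-comm-sum : ∀ {m n} (f : Subset n → Fin m → ℕ) → ∑ₛ (λ S → sum (f S)) ≡ sum (λ i → ∑ₛ (λ S → f S i))
∑ₛ-comm-sum {zero}  {n} f = ∑ₛ-zero {n}
∑ₛ-comm-sum {suc m} f =
  trans (∑ₛ-distrib-+ (λ S → f S zero) (λ S → sum (f S ∘ suc)))
        (cong (∑ₛ (λ S → f S zero) +_) (∑ₛ-comm-sum (λ S → f S ∘ suc)))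

∑ₛ-mono-≤ : ∀ {n} {f g : Subset n → ℕ} → (∀ S → f S ≤ g S) → ∑ₛ f ≤ ∑ₛ g
∑ₛ-mono-≤ {zero}  f≤g = f≤g Vec.[]
∑ₛ-mono-≤ {suc n} f≤g = +-mono-≤ (∑ₛ-mono-≤ (f≤g ∘ (outside Vec.∷_))) (∑ₛ-mono-≤ (f≤g ∘ (inside Vec.∷_)))

-- One half of the sum is bounded by `f≤g` and cancelled, so the reversed inequality of totals
-- passes to the other half, and at last to a single subset. It turns equality in the bound into
-- information about each triple.
∑ₛ-tight : ∀ {n} {f g : Subset n → ℕ} → (∀ S → f S ≤ g S) → ∑ₛ g ≤ ∑ₛ f → ∀ S → g S ≤ f S
∑ₛ-tight f≤g ∑g≤∑f Vec.[] = ∑g≤∑f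
∑ₛ-tight {suc n} {f} {g} f≤g ∑g≤∑f (s Vec.∷ S) = ∑ₛ-tight (f≤g ∘ (s Vec.∷_)) (half s) S
  where
  out≤ = ∑ₛ-mono-≤ (f≤g ∘ (outside Vec.∷_))
  in≤  = ∑ₛ-mono-≤ (f≤g ∘ (inside Vec.∷_))
  half : ∀ s → ∑ₛ (g ∘ (s Vec.∷_)) ≤ ∑ₛ (f ∘ (s Vec.∷_))
  half false = +-cancelʳ-≤ (∑ₛ (g ∘ (inside Vec.∷_))) _ _ (≤-trans ∑g≤∑f (+-monoʳ-≤ (∑ₛ (f ∘ (outside Vec.∷_))) in≤))
  half true  = +-cancelˡ-≤ (∑ₛ (g ∘ (outside Vec.∷_))) _ _ (≤-trans ∑g≤∑f (+-monoˡ-≤ (∑ₛ (f ∘ (inside Vec.∷_))) out≤))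

length-filter-allSubsets : ∀ {n} {P : Subset n → Set} (P? : Unary.Decidable P) →
  length (filter P? (allSubsets n)) ≡ ∑ₛ (λ S → 𝟙 (does (P? S)))
length-filter-allSubsets {zero}  P? = trans (length-filter-∷ P? Vec.[] []) (+-identityʳ _)
length-filter-allSubsets {suc n} P? =
  trans (length-filter-++ P? (map (outside Vec.∷_) (allSubsets n)) _)
    (cong₂ _+_
      (trans (length-filter-map P? (outside Vec.∷_) (allSubsets n)) (length-filter-allSubsets (P? ∘ (outside Vec.∷_))))
      (trans (length-filter-map P? (inside Vec.∷_) (allSubsets n)) (length-filter-allSubsets (P? ∘ (inside Vec.∷_)))))

σ₁-∑ₛ : ∀ {n} (G : Graph n) → σ₁ G ≡ ∑ₛ (λ S → 𝟙 (edgesIn (adjᵇ G) S ≡ᵇ 1))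
σ₁-∑ₛ G = trans (length-filter-allSubsets (oneNearlyIndependent? G))
  -- The decision of `m ≡ 1` computes to `m ≡ᵇ 1`, so only the edge count is rewritten.
  (∑ₛ-cong (λ S → cong (λ e → 𝟙 (e ≡ᵇ 1)) (length-inducedEdges G S)))

-- Subsets of given size through given vertices, and double counting of edges.

#subsets-size : ∀ n k → ∑ₛ {n} (λ S → 𝟙 (∣ S ∣ ≡ᵇ k)) ≡ n C k
#subsets-size zero    zero    = refl
#subsets-size zero    (suc k) = refl
#subsets-size (suc n) zero    =
  trans (cong₂ _+_ (#subsets-size n 0) (∑ₛ-zero {n})) (trans (+-identityʳ _) (trans (nC0≡1 n) (sym (nC0≡1 (suc n)))))
#subsets-size (suc n) (suc k) =
  trans (cong₂ _+_ (#subsets-size n (suc k)) (#subsets-size n k))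
        (trans (+-comm (n C suc k) _) (nCk+nC[k+1]≡[n+1]C[k+1] n k))

∋⇒size≢0 : ∀ {n} (S : Subset n) j → lookup S j ∧ (∣ S ∣ ≡ᵇ 0) ≡ false
∋⇒size≢0 (true  Vec.∷ S) j       = ∧-zeroʳ (lookup (true Vec.∷ S) j)
∋⇒size≢0 (false Vec.∷ S) zero    = refl
∋⇒size≢0 (false Vec.∷ S) (suc j) = ∋⇒size≢0 S j

-- Pascal's rule, by whether the first vertex is chosen. When `k` is 0 and `j` is not the first
-- vertex, choosing the first vertex leaves no room for `j`, so that half is zero.
#subsets-size-∋ : ∀ {n} (j : Fin n) k → ∑ₛ (λ S → 𝟙 (lookup S j ∧ (∣ S ∣ ≡ᵇ suc k))) ≡ (n ∸ 1) C k
#subsets-size-∋ {suc n} zero k = cong₂ _+_ (∑ₛ-zero {n}) (#subsets-size n k)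
#subsets-size-∋ {suc (suc n)} (suc j) zero =
  trans (cong₂ _+_ (#subsets-size-∋ j 0) (trans (∑ₛ-cong (λ S → cong 𝟙 (∋⇒size≢0 S j))) (∑ₛ-zero {suc n})))
        (trans (+-identityʳ _) (trans (nC0≡1 n) (sym (nC0≡1 (suc n)))))
#subsets-size-∋ {suc (suc n)} (suc j) (suc k) =
  trans (cong₂ _+_ (#subsets-size-∋ j (suc k)) (#subsets-size-∋ j k))
        (trans (+-comm (n C suc k) _) (nCk+nC[k+1]≡[n+1]C[k+1] n k))

∋∋⇒size≢1 : ∀ {n} (S : Subset n) i j → does (i <? j) ≡ true → lookup S i ∧ lookup S j ∧ (∣ S ∣ ≡ᵇ 1) ≡ false
∋∋⇒size≢1 (true  Vec.∷ S) zero    (suc j) i<j = ∋⇒size≢0 S j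
∋∋⇒size≢1 (false Vec.∷ S) zero    (suc j) i<j = refl
∋∋⇒size≢1 (true  Vec.∷ S) (suc i) (suc j) i<j =
  trans (cong (lookup S i ∧_) (∋⇒size≢0 S j)) (∧-zeroʳ (lookup S i))
∋∋⇒size≢1 (false Vec.∷ S) (suc i) (suc j) i<j = ∋∋⇒size≢1 S i j i<j

#subsets-size-∋∋ : ∀ {n} (i j : Fin n) k → does (i <? j) ≡ true →
  ∑ₛ (λ S → 𝟙 (lookup S i ∧ lookup S j ∧ (∣ S ∣ ≡ᵇ suc (suc k)))) ≡ (n ∸ 2) C k
#subsets-size-∋∋ {suc n} zero (suc j) k i<j = cong₂ _+_ (∑ₛ-zero {n}) (#subsets-size-∋ j k)
-- Two ordered vertices after `zero` need at least three vertices in all; with this case gone,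
-- `n ∸ 2` reduces in the remaining clauses.
#subsets-size-∋∋ {suc (suc zero)} (suc zero) (suc zero) k ()
#subsets-size-∋∋ {suc (suc (suc n))} (suc i) (suc j) zero i<j =
  trans (cong₂ _+_ (#subsets-size-∋∋ i j 0 i<j)
                   (trans (∑ₛ-cong (λ S → cong 𝟙 (∋∋⇒size≢1 S i j i<j))) (∑ₛ-zero {suc (suc n)})))
        (trans (+-identityʳ _) (trans (nC0≡1 n) (sym (nC0≡1 (suc n)))))
#subsets-size-∋∋ {suc (suc (suc n))} (suc i) (suc j) (suc k) i<j =
  trans (cong₂ _+_ (#subsets-size-∋∋ i j (suc k) i<j) (#subsets-size-∋∋ i j k i<j))
        (trans (+-comm (n C suc k) _) (nCk+nC[k+1]≡[n+1]C[k+1] n k))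

-- Double counting: after exchanging the sums, each edge is counted once for every set of size k + 2
-- containing both its ends, and the other k elements are chosen from n - 2 vertices.
∑ₛ-size-edgesIn : ∀ {n} (a : BoolRel n) k →
  ∑ₛ (λ S → 𝟙 (∣ S ∣ ≡ᵇ suc (suc k)) * edgesIn a S) ≡ edgesIn a ⊤ * ((n ∸ 2) C k)
∑ₛ-size-edgesIn {n} a k = begin
  ∑ₛ (λ S → sized S * sum (λ i → sum (λ j → edge S i j)))
    ≡⟨ ∑ₛ-cong (λ S → *-distribˡ-∑∑ (sized S) (edge S)) ⟩
  ∑ₛ (λ S → sum (λ i → sum (λ j → sized S * edge S i j)))
    ≡⟨ trans (∑ₛ-comm-sum (λ S i → sum (λ j → sized S * edge S i j)))
             (sum-cong-≗ (λ i → ∑ₛ-comm-sum (λ S j → sized S * edge S i j))) ⟩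
  sum (λ i → sum (λ j → ∑ₛ (λ S → sized S * edge S i j)))
    ≡⟨ sum-cong-≗ (λ i → sum-cong-≗ (λ j → supersets i j)) ⟩
  sum (λ i → sum (λ j → edge ⊤ i j * c))
    ≡⟨ *-distribʳ-∑∑ c (edge ⊤) ⟨
  edgesIn a ⊤ * c ∎
  where
  open ≡-Reasoning
  c = (n ∸ 2) C k
  sized : Subset n → ℕ
  sized S = 𝟙 (∣ S ∣ ≡ᵇ suc (suc k))
  edge : Subset n → Fin n → Fin n → ℕ
  edge S i j = 𝟙 (does (i <? j) ∧ lookup S i ∧ lookup S j ∧ a i j)
  rearrange : ∀ z p q → 𝟙 z * 𝟙 (p ∧ q ∧ true) ≡ 𝟙 (p ∧ q ∧ z)
  rearrange true  true  true  = refl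
  rearrange false true  true  = refl
  rearrange z     true  false = *-zeroʳ (𝟙 z)
  rearrange z     false _     = *-zeroʳ (𝟙 z)
  kill : ∀ p q → 𝟙 (p ∧ q ∧ false) ≡ 0
  kill p q = cong 𝟙 (trans (cong (p ∧_) (∧-zeroʳ q)) (∧-zeroʳ p))
  supersets : ∀ i j → ∑ₛ (λ S → sized S * edge S i j) ≡ edge ⊤ i j * c
  supersets i j with does (i <? j) in i<j | a i j
  ... | false | _ = trans (∑ₛ-cong (λ S → *-zeroʳ (sized S))) (∑ₛ-zero {n})
  ... | true  | false =
    trans (∑ₛ-cong (λ S → trans (cong (sized S *_) (kill (lookup S i) (lookup S j))) (*-zeroʳ (sized S))))
          (trans (∑ₛ-zero {n}) (sym (cong (_* c) (kill (lookup ⊤ i) (lookup ⊤ j)))))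
  ... | true  | true  =
    trans (∑ₛ-cong (λ S → rearrange (∣ S ∣ ≡ᵇ suc (suc k)) (lookup S i) (lookup S j)))
          (trans (#subsets-size-∋∋ i j k i<j)
                 (trans (sym (*-identityˡ c))
                        (cong (_* c) (sym (cong₂ (λ p q → 𝟙 (p ∧ q ∧ true))
                                            (lookup-replicate i true) (lookup-replicate j true))))))

-- Edge counts under complementation and vertex insertion.

#edges : ∀ {n} → Graph n → Subset n → ℕ
#edges G = edgesIn (adjᵇ G)

adjᵇ-sym : ∀ {n} (G : Graph n) i j → adjᵇ G i j ≡ adjᵇ G j i
adjᵇ-sym G i j = does-⇔ (mk⇔ (symm G) (symm G)) (adj? G i j) (adj? G j i)

#edges-complement : ∀ {n} (G : Graph n) S → #edges G S + #edges (complement G) S ≡ ∣ S ∣ C 2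
#edges-complement G = edgesIn-complement (adjᵇ G) (adjᵇ (complement G))
  -- The complement's decision is the conjunction of `not (does (i ≟ j))` and `not (adjᵇ G i j)`;
  -- off the diagonal the first factor is true.
  λ i j i≢j → cong (λ b → not b ∧ not (adjᵇ G i j)) (dec-false (i ≟ j) i≢j)

lookup-insert-mono : ∀ {n} (S : Subset n) u v → lookup S u ≡ inside → lookup (S [ v ]≔ inside) u ≡ inside
lookup-insert-mono S u v u∈S with u ≟ v
... | yes refl = lookup∘update v S inside
... | no u≢v   = trans (lookup∘update′ u≢v S inside) u∈S

∈∉⇒≢ : ∀ {n} (S : Subset n) {u v} → lookup S u ≡ inside → lookup S v ≡ outside → u ≢ v
∈∉⇒≢ S u∈S v∉S refl with () ← trans (sym u∈S) v∉S

≤sum : ∀ {n} (f : Fin n → ℕ) i → f i ≤ sum f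
≤sum f zero    = m≤m+n (f zero) _
≤sum f (suc i) = ≤-trans (≤sum (f ∘ suc) i) (m≤n+m _ (f zero))

#edges-insert : ∀ {n} (G : Graph n) (S : Subset n) v → lookup S v ≡ outside →
  #edges G (S [ v ]≔ inside) ≡ #edges G S + degreeIn (adjᵇ G) S v
#edges-insert G = edgesIn-insert (adjᵇ G) (adjᵇ-sym G)

#edges-insert-≤ : ∀ {n} (G : Graph n) (S : Subset n) v → lookup S v ≡ outside →
  #edges G S ≤ #edges G (S [ v ]≔ inside)
#edges-insert-≤ G S v v∉S = ≤-trans (m≤m+n _ _) (≤-reflexive (sym (#edges-insert G S v v∉S)))

#edges-insert-< : ∀ {n} (G : Graph n) (S : Subset n) {u} v → lookup S v ≡ outside →
  lookup S u ≡ inside → Adj G v u → #edges G S < #edges G (S [ v ]≔ inside)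
#edges-insert-< G S {u} v v∉S u∈S vu = begin
  suc (#edges G S)                        ≡⟨ +-comm 1 _ ⟩
  #edges G S + 1
    ≡⟨ cong (#edges G S +_) (cong₂ (λ p q → 𝟙 (p ∧ q)) u∈S (dec-true (adj? G v u) vu)) ⟨
  #edges G S + 𝟙 (lookup S u ∧ adjᵇ G v u)
    ≤⟨ +-monoʳ-≤ (#edges G S) (≤sum (λ j → 𝟙 (lookup S j ∧ adjᵇ G v j)) u) ⟩
  #edges G S + degreeIn (adjᵇ G) S v      ≡⟨ #edges-insert G S v v∉S ⟨
  #edges G (S [ v ]≔ inside)              ∎
  where open ≤-Reasoning

-- Presents a nonempty set as an insertion, the form to which the insertion lemmas for `#edges`
-- apply.
∃-remove : ∀ {n} (S : Subset n) {k} → ∣ S ∣ ≡ suc k →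
  ∃[ v ] ∃[ S′ ] lookup S′ v ≡ outside × S ≡ S′ [ v ]≔ inside × ∣ S′ ∣ ≡ k
∃-remove (true  Vec.∷ S) refl = zero , outside Vec.∷ S , refl , refl , refl
∃-remove (false Vec.∷ S) eq with ∃-remove S eq
... | v , S′ , v∉S′ , refl , eq′ = suc v , outside Vec.∷ S′ , v∉S′ , refl , eq′

-- Short cycles and triples of vertices in acyclic graphs.

TriangleFree : ∀ {n} → Graph n → Set
TriangleFree G = ∀ {a b c} → Adj G a b → Adj G b c → ¬ Adj G c a

≢-adj : ∀ {n} (G : Graph n) {i j} → Adj G i j → i ≢ j
≢-adj G ij i≡j = irrefl G i≡j ij

acyclic⇒triangleFree : ∀ {n} (G : Graph n) → Acyclic G → TriangleFree G
acyclic⇒triangleFree G acyclic {a} {b} {c} ab bc ca = acyclic a (b ∷ c ∷ []) record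
  { long     = s≤s (s≤s z≤n)
  ; distinct = (≢-adj G ab ∷ ≢-adj G ca ∘ sym ∷ []) ∷ (≢-adj G bc ∷ []) ∷ [] ∷ []
  ; closed   = ab ∷ bc ∷ ca ∷ [-]
  }

acyclic⇒squareFree : ∀ {n} (G : Graph n) → Acyclic G → ∀ {a b c d} → a ≢ c → b ≢ d →
  Adj G a b → Adj G b c → Adj G c d → ¬ Adj G d a
acyclic⇒squareFree G acyclic {a} {b} {c} {d} a≢c b≢d ab bc cd da = acyclic a (b ∷ c ∷ d ∷ []) record
  { long     = s≤s (s≤s z≤n)
  ; distinct = (≢-adj G ab ∷ a≢c ∷ ≢-adj G da ∘ sym ∷ []) ∷ (≢-adj G bc ∷ b≢d ∷ []) ∷ (≢-adj G cd ∷ []) ∷ [] ∷ []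
  ; closed   = ab ∷ bc ∷ cd ∷ da ∷ [-]
  }

-- The triple is built by inserting `a`, `b`, `c` in turn. A nonadjacent pair raises the
-- complement's count when its later vertex is inserted, and later insertions never lower it; three
-- adjacent pairs would form a triangle.
triangleFree⇒nonedge : ∀ {n} (G : Graph n) → TriangleFree G →
  ∀ S → ∣ S ∣ ≡ 3 → 1 ≤ #edges (complement G) S
triangleFree⇒nonedge G △-free S ∣S∣≡3 with ∃-remove S ∣S∣≡3
... | c , S₂ , c∉S₂ , refl , ∣S₂∣≡2 with ∃-remove S₂ ∣S₂∣≡2
... | b , S₁ , b∉S₁ , refl , ∣S₁∣≡1 with ∃-remove S₁ ∣S₁∣≡1
... | a , S₀ , _ , refl , _ = go (adj? G b a) (adj? G c b) (adj? G c a)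
  where
  Ḡ = complement G
  a∈S₁ = lookup∘update a S₀ inside
  a∈S₂ = lookup-insert-mono S₁ a b a∈S₁
  b∈S₂ = lookup∘update b S₁ inside
  ≥1 : ∀ {m n} → m < n → 1 ≤ n
  ≥1 = ≤-trans (s≤s z≤n)
  nonadj : ∀ {S u} v → lookup S u ≡ inside → lookup S v ≡ outside → ¬ Adj G v u → Adj Ḡ v u
  nonadj {S} v u∈S v∉S ¬vu = ∈∉⇒≢ S u∈S v∉S ∘ sym , ¬vu
  go : Dec (Adj G b a) → Dec (Adj G c b) → Dec (Adj G c a) → 1 ≤ #edges Ḡ (S₂ [ c ]≔ inside)
  go (no ¬ba) _ _ = ≤-trans (≥1 (#edges-insert-< Ḡ S₁ b b∉S₁ a∈S₁ (nonadj {S₁} b a∈S₁ b∉S₁ ¬ba)))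
                            (#edges-insert-≤ Ḡ S₂ c c∉S₂)
  go _ (no ¬cb) _ = ≥1 (#edges-insert-< Ḡ S₂ c c∉S₂ b∈S₂ (nonadj {S₂} c b∈S₂ c∉S₂ ¬cb))
  go _ _ (no ¬ca) = ≥1 (#edges-insert-< Ḡ S₂ c c∉S₂ a∈S₂ (nonadj {S₂} c a∈S₂ c∉S₂ ¬ca))
  go (yes ba) (yes cb) (yes ca) = contradiction (symm G ca) (△-free cb ba)

-- Connected graphs have at least n - 1 edges.

∃-∉ : ∀ {n} (S : Subset n) → ∣ S ∣ < n → ∃[ v ] lookup S v ≡ outside
∃-∉ (false Vec.∷ S) _          = zero , refl
∃-∉ (true  Vec.∷ S) (s≤s ∣S∣<n) with ∃-∉ S ∣S∣<n
... | v , v∉S = suc v , v∉S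

-- Takes the first step of the walk that leaves `S`.
crossing-edge : ∀ {n} (G : Graph n) (S : Subset n) {x y} → Star (Adj G) x y →
  lookup S x ≡ inside → lookup S y ≡ outside →
  ∃[ u ] ∃[ v ] lookup S u ≡ inside × lookup S v ≡ outside × Adj G v u
crossing-edge G S ε x∈S y∉S = contradiction refl (∈∉⇒≢ S x∈S y∉S)
crossing-edge G S (_◅_ {x} {z} xz zy) x∈S y∉S with lookup S z in eq
... | true  = crossing-edge G S zy eq y∉S
... | false = x , z , x∈S , eq , symm G xz

-- Greedy growth from a single vertex: as long as a vertex is missing, some edge crosses out of `S`,
-- and adding its outer end gains at least that edge.
connected-grow : ∀ {n} (G : Graph n) → Connected G → ∀ k → k < n →
  ∃[ S ] ∣ S ∣ ≡ suc k × k ≤ #edges G S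
connected-grow {suc n} G conn zero    _    = ⁅ zero ⁆ , ∣⁅x⁆∣≡1 {suc n} zero , z≤n
connected-grow G conn (suc k) k<n with connected-grow G conn k (<⇒≤ k<n)
... | S , ∣S∣≡ , k≤e with ∃-remove S ∣S∣≡ | ∃-∉ S (subst (_< _) (sym ∣S∣≡) k<n)
... | x , S′ , _ , refl , _ | y , y∉S
  with crossing-edge G S (conn x y) (lookup∘update x S′ inside) y∉S
... | u , v , u∈S , v∉S , vu =
  S [ v ]≔ inside , trans (size-insert S v v∉S) (cong suc ∣S∣≡) ,
  ≤-trans (s≤s k≤e) (#edges-insert-< G S v v∉S u∈S vu)

connected⇒#edges≥ : ∀ {n} (G : Graph n) → Connected G → n ∸ 1 ≤ #edges G ⊤
connected⇒#edges≥ {zero}  G conn = z≤n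
connected⇒#edges≥ {suc n} G conn with connected-grow G conn n ≤-refl
... | S , ∣S∣≡ , n≤e = subst (λ S → n ≤ #edges G S) (∣p∣≡n⇒p≡⊤ {p = S} ∣S∣≡) n≤e

-- The triple {u, v, w} has at least one edge, `uv`, and at least two nonedges, `uw` and `vw`. Edges
-- and nonedges total 3, so both bounds are attained.
one-edge-triple : ∀ {n} (G : Graph n) {u v w} → Adj G u v → w ≢ u → w ≢ v →
  ¬ Adj G u w → ¬ Adj G v w → ∃[ S ] ∣ S ∣ ≡ 3 × #edges G S ≡ 1
one-edge-triple {n} G {u} {v} {w} uv w≢u w≢v ¬uw ¬vw =
  S₃ , ∣S₃∣≡3 , squeeze (trans (#edges-complement G S₃) (cong (_C 2) ∣S₃∣≡3)) 1≤e 2≤ē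
  where
  Ḡ = complement G
  S₁ = ⊥ {n} [ w ]≔ inside
  S₂ = S₁ [ u ]≔ inside
  S₃ = S₂ [ v ]≔ inside
  w∈S₁ : lookup S₁ w ≡ inside
  w∈S₁ = lookup∘update w ⊥ inside
  w∈S₂ : lookup S₂ w ≡ inside
  w∈S₂ = lookup-insert-mono S₁ w u w∈S₁
  w∉⊥ : lookup ⊥ w ≡ outside
  w∉⊥ = lookup-replicate w outside
  u∉S₁ : lookup S₁ u ≡ outside
  u∉S₁ = trans (lookup∘update′ (w≢u ∘ sym) ⊥ inside) (lookup-replicate u outside)
  v∉S₂ : lookup S₂ v ≡ outside
  v∉S₂ = trans (lookup∘update′ (≢-adj G uv ∘ sym) S₁ inside)
               (trans (lookup∘update′ (w≢v ∘ sym) ⊥ inside) (lookup-replicate v outside))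
  ∣S₃∣≡3 : ∣ S₃ ∣ ≡ 3
  ∣S₃∣≡3 = trans (size-insert S₂ v v∉S₂) (cong suc (trans (size-insert S₁ u u∉S₁)
             (cong suc (trans (size-insert ⊥ w w∉⊥) (cong suc (∣⊥∣≡0 n))))))
  1≤e : 1 ≤ #edges G S₃
  1≤e = ≤-trans (s≤s z≤n) (#edges-insert-< G S₂ v v∉S₂ (lookup∘update u S₁ inside) (symm G uv))
  2≤ē : 2 ≤ #edges Ḡ S₃
  2≤ē = ≤-trans (s≤s (≤-trans (s≤s z≤n) (#edges-insert-< Ḡ S₁ u u∉S₁ w∈S₁ (w≢u ∘ sym , ¬uw))))
                (#edges-insert-< Ḡ S₂ v v∉S₂ w∈S₂ (w≢v ∘ sym , ¬vw))
  squeeze : ∀ {e ē} → e + ē ≡ 3 → 1 ≤ e → 2 ≤ ē → e ≡ 1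
  squeeze {e} eq 1≤e 2≤ē = ≤-antisym (+-cancelʳ-≤ 2 e 1 (≤-trans (+-monoʳ-≤ e 2≤ē) (≤-reflexive eq))) 1≤e

-- Stars with an arbitrary center, and their isomorphism with K(1, m).

StarAdj : ∀ {n} → Fin n → Fin n → Fin n → Set
StarAdj c i j = (i ≡ c × j ≢ c) ⊎ (i ≢ c × j ≡ c)

IsStar : ∀ {n} → Graph n → Fin n → Set
IsStar G c = ∀ i j → Adj G i j ⇔ StarAdj c i j

mkStar : ∀ {n} (G : Graph n) c → (∀ i → i ≢ c → Adj G c i) →
  (∀ i j → i ≢ c → j ≢ c → ¬ Adj G i j) → IsStar G c
mkStar G c spoke rim i j = mk⇔ to from
  where
  to : Adj G i j → StarAdj c i j
  to ij with i ≟ c | j ≟ c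
  ... | yes refl | yes refl = contradiction ij (irrefl G refl)
  ... | yes i≡c  | no j≢c   = inj₁ (i≡c , j≢c)
  ... | no i≢c   | yes j≡c  = inj₂ (i≢c , j≡c)
  ... | no i≢c   | no j≢c   = contradiction ij (rim i j i≢c j≢c)
  from : StarAdj c i j → Adj G i j
  from (inj₁ (refl , j≢c)) = spoke j j≢c
  from (inj₂ (i≢c , refl)) = symm G (spoke i i≢c)

K-isStar : ∀ m → IsStar (K 1 m) zero
K-isStar m = mkStar (K 1 m) zero spoke rim
  where
  spoke : ∀ i → i ≢ zero → Adj (K 1 m) zero i
  spoke zero    i≢0 = contradiction refl i≢0
  spoke (suc i) _   = left-right
  rim : ∀ i j → i ≢ zero → j ≢ zero → ¬ Adj (K 1 m) i j
  rim zero    _       i≢0 _   = contradiction refl i≢0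
  rim (suc i) zero    _   j≢0 = contradiction refl j≢0
  rim (suc i) (suc j) _   _   ()

≅-star : ∀ {n} {G H : Graph n} {c} (G≅H : G ≅ H) → IsStar H (Inverse.to (proj₁ G≅H) c) → IsStar G c
≅-star {G = G} {H} {c} (f , adj⇔) H-star = mkStar G c
  (λ i i≢c → Equivalence.from (adj⇔ c i) (Equivalence.from (H-star _ _) (inj₁ (refl , i≢c ∘ inj))))
  λ i j i≢c j≢c ij → absurd i≢c j≢c (Equivalence.to (H-star _ _) (Equivalence.to (adj⇔ i j) ij))
  where
  open Inverse f using (to; from; strictlyInverseʳ)
  inj : ∀ {i j} → to i ≡ to j → i ≡ j
  inj {i} {j} eq = trans (sym (strictlyInverseʳ i)) (trans (cong from eq) (strictlyInverseʳ j))
  absurd : ∀ {i j} → i ≢ c → j ≢ c → ¬ StarAdj (to c) (to i) (to j)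
  absurd i≢c _ (inj₁ (i≡ , _)) = i≢c (inj i≡)
  absurd _ j≢c (inj₂ (_ , j≡)) = j≢c (inj j≡)

-- Adjacency in a star depends only on which end is the center, so any bijection taking `c` to `d`
-- is an isomorphism; the transposition of `c` and `d` is one.
star-≅ : ∀ {n} {G H : Graph n} {c d} → IsStar G c → IsStar H d → G ≅ H
star-≅ {G = G} {H} {c} {d} G-star H-star = π , λ i j → mk⇔
  (λ ij → Equivalence.from (H-star _ _) (fwd (Equivalence.to (G-star i j) ij)))
  (λ ij → Equivalence.from (G-star i j) (bwd (Equivalence.to (H-star _ _) ij)))
  where
  π = transpose c d
  open Inverse π using (to; from; strictlyInverseʳ)
  to-c : to c ≡ d
  to-c with c ≟ c
  ... | yes _  = refl
  ... | no c≢c = contradiction refl c≢c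
  inj : ∀ {i j} → to i ≡ to j → i ≡ j
  inj {i} {j} eq = trans (sym (strictlyInverseʳ i)) (trans (cong from eq) (strictlyInverseʳ j))
  to≡d⇒ : ∀ {i} → to i ≡ d → i ≡ c
  to≡d⇒ eq = inj (trans eq (sym to-c))
  ⇒to≡d : ∀ {i} → i ≡ c → to i ≡ d
  ⇒to≡d refl = to-c
  fwd : ∀ {i j} → StarAdj c i j → StarAdj d (to i) (to j)
  fwd (inj₁ (i≡c , j≢c)) = inj₁ (⇒to≡d i≡c , j≢c ∘ to≡d⇒)
  fwd (inj₂ (i≢c , j≡c)) = inj₂ (i≢c ∘ to≡d⇒ , ⇒to≡d j≡c)
  bwd : ∀ {i j} → StarAdj d (to i) (to j) → StarAdj c i j
  bwd (inj₁ (i≡ , j≢)) = inj₁ (to≡d⇒ i≡ , j≢ ∘ ⇒to≡d)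
  bwd (inj₂ (i≢ , j≡)) = inj₂ (i≢ ∘ ⇒to≡d , to≡d⇒ j≡)

star⇔≅K : ∀ {m} (G : Graph (suc m)) → (∃[ c ] IsStar G c) ⇔ (G ≅ K 1 m)
star⇔≅K {m} G = mk⇔ (λ (c , G-star) → star-≅ {G = G} {K 1 m} G-star (K-isStar m))
  -- The center is the preimage of `zero`, the only vertex of the first part.
  λ G≅K@(f , _) → Inverse.from f zero ,
    ≅-star {G = G} {K 1 m} G≅K (subst (IsStar (K 1 m)) (sym (Inverse.strictlyInverseˡ f zero)) (K-isStar m))

-- Stars: edge counts, and recognition among trees.

star-#edges-∌ : ∀ {n} (G : Graph n) {c} → IsStar G c → ∀ S → lookup S c ≡ outside → #edges G S ≡ 0
star-#edges-∌ {n} G {c} G-star S c∉S =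
  trans (sum-cong-≗ (λ i → trans (sum-cong-≗ (edge≡0 i)) (sum-replicate-zero n))) (sum-replicate-zero n)
  where
  edge≡0 : ∀ i j → 𝟙 (does (i <? j) ∧ lookup S i ∧ lookup S j ∧ adjᵇ G i j) ≡ 0
  edge≡0 i j with does (i <? j) | lookup S i in i∈S | lookup S j in j∈S | adj? G i j
  ... | false | _     | _     | _      = refl
  ... | true  | false | _     | _      = refl
  ... | true  | true  | false | _      = refl
  ... | true  | true  | true  | no _   = refl
  ... | true  | true  | true  | yes ij with Equivalence.to (G-star i j) ij
  ...   | inj₁ (refl , _) = contradiction refl (∈∉⇒≢ S i∈S c∉S)
  ...   | inj₂ (_ , refl) = contradiction refl (∈∉⇒≢ S j∈S c∉S)

-- Without the center `S` spans no edge, and the center is adjacent to everything that remains, so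
-- putting it back adds one edge per remaining vertex.
star-#edges-∋ : ∀ {n} (G : Graph n) {c} → IsStar G c → ∀ S → lookup S c ≡ inside → suc (#edges G S) ≡ ∣ S ∣
star-#edges-∋ {n} G {c} G-star S c∈S = begin
  suc (#edges G S)                                      ≡⟨ cong (suc ∘ #edges G) S≡ ⟩
  suc (#edges G (S′ [ c ]≔ inside))                     ≡⟨ cong suc (#edges-insert G S′ c c∉S′) ⟩
  suc (#edges G S′ + degreeIn (adjᵇ G) S′ c)
    ≡⟨ cong₂ (λ x y → suc (x + y)) (star-#edges-∌ G G-star S′ c∉S′) degree ⟩
  suc ∣ S′ ∣                                             ≡⟨ size-insert S′ c c∉S′ ⟨
  ∣ S′ [ c ]≔ inside ∣                                   ≡⟨ cong ∣_∣ S≡ ⟨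
  ∣ S ∣                                                  ∎
  where
  open ≡-Reasoning
  S′ = S [ c ]≔ outside
  c∉S′ : lookup S′ c ≡ outside
  c∉S′ = lookup∘update c S outside
  S≡ : S ≡ S′ [ c ]≔ inside
  S≡ = sym (trans ([]≔-idempotent S c) (trans (cong (S [ c ]≔_) (sym c∈S)) ([]≔-lookup S c)))
  spoke : ∀ j → 𝟙 (lookup S′ j ∧ adjᵇ G c j) ≡ 𝟙 (lookup S′ j)
  spoke j with lookup S′ j in j∈S′
  ... | false = refl
  ... | true  = cong 𝟙 (dec-true (adj? G c j)
    (Equivalence.from (G-star c j) (inj₁ (refl , ∈∉⇒≢ S′ j∈S′ c∉S′))))
  degree : degreeIn (adjᵇ G) S′ c ≡ ∣ S′ ∣
  degree = trans (sum-cong-≗ spoke) (sum-lookup S′)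

-- Fix an edge `uv`. If `u` is adjacent to all other vertices, it is the center, since an edge
-- between two neighbours would close a triangle. Otherwise some `x` is not adjacent to `u`, and a
-- 4-cycle argument makes `v` the center.
no-one-edge-triple⇒star : ∀ {n} (G : Graph (suc n)) → IsTree G →
  (∀ S → ∣ S ∣ ≡ 3 → #edges G S ≢ 1) → ∃[ c ] IsStar G c
no-one-edge-triple⇒star {zero} G _ _ = zero , mkStar G zero
  (λ { zero i≢0 → contradiction refl i≢0 }) (λ { zero _ i≢0 _ → contradiction refl i≢0 })
no-one-edge-triple⇒star {suc n} G tree none with IsTree.connected tree zero (suc zero)
-- A walk between the distinct vertices `zero` and `suc zero` has a first step, which supplies the
-- edge.
... | _◅_ {u} {v} uv _ = center
  where
  △-free = acyclic⇒triangleFree G (IsTree.acyclic tree)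
  -- A vertex adjacent to neither end of an edge would make a triple with exactly one edge.
  attached : ∀ {u v w} → Adj G u v → w ≢ u → w ≢ v → ¬ Adj G u w → Adj G v w
  attached {u} {v} {w} uv w≢u w≢v ¬uw = decidable-stable (adj? G v w) λ ¬vw →
    let S , ∣S∣≡3 , e≡1 = one-edge-triple G uv w≢u w≢v ¬uw ¬vw in none S ∣S∣≡3 e≡1
  dominating⇒star : ∀ c → (∀ i → i ≢ c → Adj G c i) → IsStar G c
  dominating⇒star c spoke = mkStar G c spoke
    λ i j i≢c j≢c ij → △-free (spoke i i≢c) ij (symm G (spoke j j≢c))
  reached? : ∀ w → Dec (w ≡ u ⊎ Adj G u w)
  reached? w = (w ≟ u) ⊎-dec adj? G u w
  center : ∃[ c ] IsStar G c
  center with all? reached?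
  ... | yes reached = u , dominating⇒star u λ i i≢u → unwrap i≢u (reached i)
    where
    unwrap : ∀ {i} → i ≢ u → i ≡ u ⊎ Adj G u i → Adj G u i
    unwrap i≢u (inj₁ i≡u) = contradiction i≡u i≢u
    unwrap _   (inj₂ ui)  = ui
  ... | no ¬reached with ¬∀⟶∃¬ _ _ reached? ¬reached
  ... | x , x-far = v , dominating⇒star v λ w w≢v → decidable-stable (adj? G v w) (v-spoke w w≢v)
    where
    x≢u : x ≢ u
    x≢u = x-far ∘ inj₁
    ¬ux : ¬ Adj G u x
    ¬ux = x-far ∘ inj₂
    x≢v : x ≢ v
    x≢v refl = ¬ux uv
    v-spoke : ∀ w → w ≢ v → ¬ ¬ Adj G v w
    -- If `w` misses `v`, then edge `uv` attaches `w` to `u`, and edge `uw` attaches `x` to `w`. As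
    -- `x` is also attached to `v`, the 4-cycle u, v, x, w closes.
    v-spoke w w≢v ¬vw = acyclic⇒squareFree G (IsTree.acyclic tree) (x≢u ∘ sym) (w≢v ∘ sym)
      uv (attached uv x≢u x≢v ¬ux) (symm G wx) (symm G uw)
      where
      w≢u : w ≢ u
      w≢u refl = ¬vw (symm G uv)
      uw : Adj G u w
      uw = attached (symm G uv) w≢v w≢u ¬vw
      x≢w : x ≢ w
      x≢w refl = ¬ux uw
      wx : Adj G w x
      wx = attached uw x≢u x≢w ¬ux

-- Comparison of weights and contributions on each subset.

-- Summed over S, the weights of the sets with |S| = 2 and |S| = 3 give
-- 2 (n C 2) and e(T) (n − 2), since each edge lies in n − 2 triples.
weight : ℕ → ℕ → ℕ
weight s e = 2 * 𝟙 (s ≡ᵇ 2) + 𝟙 (s ≡ᵇ 3) * e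

contribution : ℕ → ℕ → ℕ
contribution e ē = 𝟙 (e ≡ᵇ 1) + 𝟙 (ē ≡ᵇ 1)

-- Contributions are doubled because a triple is credited with e / 2. A pair has e + ē = 1, so it
-- contributes exactly 1. A triple with e = 2 gives equality, and one with e = 1 has weight 1
-- against at least 2; this strictness later decides the equality case.
weight-≤ : ∀ s e ē → e + ē ≡ s C 2 → (s ≡ 3 → 1 ≤ ē) → weight s e ≤ 2 * contribution e ē
weight-≤ 0 e ē _ _ = z≤n
weight-≤ 1 e ē _ _ = z≤n
weight-≤ 2 0 .1 refl _ = ≤-refl
weight-≤ 2 1 .0 refl _ = ≤-refl
weight-≤ 3 0 ē _ _ = z≤n
weight-≤ 3 1 ē _ _ = s≤s z≤n
weight-≤ 3 2 .1 refl _ = ≤-refl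
-- Three edges already exhaust the 3 pairs, which forces `ē` to be 0 against `ē≥1`.
weight-≤ 3 (suc (suc (suc e))) ē eq ē≥1
  with refl ← m+n≡0⇒n≡0 e (cong (_∸ 3) eq) | () ← ē≥1 refl
weight-≤ (suc (suc (suc (suc s)))) e ē _ _ = z≤n

2≤⇒≢ᵇ1 : ∀ {n} → 2 ≤ n → 𝟙 (n ≡ᵇ 1) ≡ 0
2≤⇒≢ᵇ1 (s≤s (s≤s _)) = refl

2≤nC2 : ∀ n → 3 ≤ n → 2 ≤ n C 2
2≤nC2 (suc n) (s≤s 2≤n) = ≤-trans 2≤n (≤-trans (m≤m+n n _) (≤-reflexive (sym (pascal₂ n))))

-- An edgeless set has ē = s C 2, and a set with e = s - 1 has e ≥ 3 and, by Pascal's rule, ē = e C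
-- 2. These numbers are at least 2, while an edgeless set has e = 0, so neither count is 1.
star-contribution : ∀ s e ē → 4 ≤ s → e + ē ≡ s C 2 → e ≡ 0 ⊎ suc e ≡ s → contribution e ē ≡ 0
star-contribution s e ē 4≤s eq (inj₁ refl) =
  2≤⇒≢ᵇ1 (subst (2 ≤_) (sym eq) (2≤nC2 s (<⇒≤ 4≤s)))
star-contribution s e ē (s≤s 3≤e) eq (inj₂ refl) =
  cong₂ _+_ (2≤⇒≢ᵇ1 (<⇒≤ 3≤e)) (2≤⇒≢ᵇ1 (subst (2 ≤_) (sym ē≡) (2≤nC2 e 3≤e)))
  where
  ē≡ : ē ≡ e C 2
  ē≡ = +-cancelˡ-≡ e ē _ (trans eq (pascal₂ e))

star-weight : ∀ s e ē → e + ē ≡ s C 2 → e ≡ 0 ⊎ suc e ≡ s → weight s e ≡ 2 * contribution e ē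
star-weight 0 0 .0 refl _ = refl
star-weight 1 0 .0 refl _ = refl
star-weight 2 0 .1 refl _ = refl
star-weight 2 1 .0 refl _ = refl
star-weight 3 0 .3 refl _ = refl
star-weight 3 2 .1 refl _ = refl
star-weight 3 1 _ _ (inj₁ ())
star-weight 3 1 _ _ (inj₂ ())
star-weight 3 (suc (suc (suc _))) _ _ (inj₁ ())
star-weight 3 (suc (suc (suc _))) _ _ (inj₂ ())
star-weight s@(suc (suc (suc (suc _)))) e ē eq star =
  sym (cong (2 *_) (star-contribution s e ē (s≤s (s≤s (s≤s (s≤s z≤n)))) eq star))

2*nC2≡n*[n∸1] : ∀ n → 2 * (n C 2) ≡ n * (n ∸ 1)
2*nC2≡n*[n∸1] zero    = refl
2*nC2≡n*[n∸1] (suc zero) = refl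
2*nC2≡n*[n∸1] (suc (suc n)) = begin
  2 * (suc (suc n) C 2)          ≡⟨ cong (2 *_) (pascal₂ (suc n)) ⟩
  2 * (suc n + suc n C 2)        ≡⟨ *-distribˡ-+ 2 (suc n) _ ⟩
  2 * suc n + 2 * (suc n C 2)    ≡⟨ cong (2 * suc n +_) (2*nC2≡n*[n∸1] (suc n)) ⟩
  2 * suc n + suc n * n          ≡⟨ ring n ⟩
  suc (suc n) * suc n            ∎
  where
  open ≡-Reasoning
  ring : ∀ n → 2 * suc n + suc n * n ≡ suc (suc n) * suc n
  ring = solve-∀

2[n∸1]² : ∀ n → 2 * (n C 2) + (n ∸ 1) * ((n ∸ 2) C 1) ≡ 2 * (n ∸ 1) ^ 2
2[n∸1]² n = trans (cong₂ (λ x y → x + (n ∸ 1) * y) (2*nC2≡n*[n∸1] n) (nC1≡n (n ∸ 2))) (ring n)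
  where
  ring′ : ∀ n → suc (suc n) * suc n + suc n * n ≡ 2 * (suc n * (suc n * 1))
  ring′ = solve-∀
  ring : ∀ n → n * (n ∸ 1) + (n ∸ 1) * (n ∸ 2) ≡ 2 * (n ∸ 1) ^ 2
  -- Truncated subtraction in `n ∸ 2` is genuine only from 2 on; the two smaller orders are
  -- computed.
  ring zero          = refl
  ring (suc zero)    = refl
  ring (suc (suc n)) = ring′ n

-- Summation over all subsets: the bound and the equality case.

∑ₛ-weight : ∀ {n} (G : Graph n) →
  ∑ₛ (λ S → weight ∣ S ∣ (#edges G S)) ≡ 2 * (n C 2) + #edges G ⊤ * ((n ∸ 2) C 1)
∑ₛ-weight {n} G = trans (∑ₛ-distrib-+ (λ S → 2 * 𝟙 (∣ S ∣ ≡ᵇ 2)) (λ S → 𝟙 (∣ S ∣ ≡ᵇ 3) * #edges G S))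
  (cong₂ _+_ (trans (∑ₛ-distribˡ-* 2 (λ (S : Subset n) → 𝟙 (∣ S ∣ ≡ᵇ 2))) (cong (2 *_) (#subsets-size n 2)))
             (∑ₛ-size-edgesIn (adjᵇ G) 1))

∑ₛ-contribution : ∀ {n} (G : Graph n) →
  ∑ₛ (λ S → 2 * contribution (#edges G S) (#edges (complement G) S)) ≡ 2 * (σ₁ G + σ₁ (complement G))
∑ₛ-contribution G = trans (∑ₛ-distribˡ-* 2 (λ S → contribution (#edges G S) (#edges (complement G) S)))
  (cong (2 *_) (trans (∑ₛ-distrib-+ (λ S → 𝟙 (#edges G S ≡ᵇ 1)) (λ S → 𝟙 (#edges (complement G) S ≡ᵇ 1)))
                      (sym (cong₂ _+_ (σ₁-∑ₛ G) (σ₁-∑ₛ (complement G))))))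

-- Acyclicity enters the bound here, as the absence of triangles; connectedness enters in
-- `tree-∑ₛ-weight-≥`, through the number of edges.
tree-weight-≤ : ∀ {n} (T : Graph n) → IsTree T → ∀ S →
  weight ∣ S ∣ (#edges T S) ≤ 2 * contribution (#edges T S) (#edges (complement T) S)
tree-weight-≤ T tree S = weight-≤ ∣ S ∣ _ _ (#edges-complement T S)
  (triangleFree⇒nonedge T (acyclic⇒triangleFree T (IsTree.acyclic tree)) S)

tree-∑ₛ-weight-≥ : ∀ {n} (T : Graph n) → IsTree T → 2 * (n ∸ 1) ^ 2 ≤ ∑ₛ (λ S → weight ∣ S ∣ (#edges T S))
tree-∑ₛ-weight-≥ {n} T tree = begin
  2 * (n ∸ 1) ^ 2                             ≡⟨ 2[n∸1]² n ⟨
  2 * (n C 2) + (n ∸ 1) * ((n ∸ 2) C 1)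
    ≤⟨ +-monoʳ-≤ (2 * (n C 2)) (*-monoˡ-≤ ((n ∸ 2) C 1) (connected⇒#edges≥ T (IsTree.connected tree))) ⟩
  2 * (n C 2) + #edges T ⊤ * ((n ∸ 2) C 1)    ≡⟨ ∑ₛ-weight T ⟨
  ∑ₛ (λ S → weight ∣ S ∣ (#edges T S))        ∎
  where open ≤-Reasoning

tree-σ₁-≥ : ∀ {n} (T : Graph n) → IsTree T → (n ∸ 1) ^ 2 ≤ σ₁ T + σ₁ (complement T)
tree-σ₁-≥ T tree = *-cancelˡ-≤ 2 (≤-trans (tree-∑ₛ-weight-≥ T tree)
  (≤-trans (∑ₛ-mono-≤ (tree-weight-≤ T tree)) (≤-reflexive (∑ₛ-contribution T))))

-- Equality of the totals makes `weight` meet twice `contribution` at every subset, whereas a triple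
-- with exactly one edge has weight 1 and doubled contribution at least 2.
tree-σ₁-tight⇒star : ∀ {n} (T : Graph (suc n)) → IsTree T →
  σ₁ T + σ₁ (complement T) ≡ n ^ 2 → ∃[ c ] IsStar T c
tree-σ₁-tight⇒star T tree eq = no-one-edge-triple⇒star T tree λ S ∣S∣≡3 e≡1 → absurd _ _ (#edges (complement T) S) ∣S∣≡3 e≡1 (tight S)
  where
  tight = ∑ₛ-tight (tree-weight-≤ T tree)
    (≤-trans (≤-reflexive (trans (∑ₛ-contribution T) (cong (2 *_) eq))) (tree-∑ₛ-weight-≥ T tree))
  absurd : ∀ s e ē → s ≡ 3 → e ≡ 1 → ¬ 2 * contribution e ē ≤ weight s e
  absurd _ _ ē refl refl 2c≤1 with s≤s () ← ≤-trans (*-monoʳ-≤ 2 (m≤m+n 1 (𝟙 (ē ≡ᵇ 1)))) 2c≤1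

-- The chain of the lower bound again, with equalities: every subset meets its weight by
-- `star-weight`, and the star has exactly n - 1 edges.
star-σ₁ : ∀ {n} (G : Graph n) {c} → IsStar G c → σ₁ G + σ₁ (complement G) ≡ (n ∸ 1) ^ 2
star-σ₁ {n} G {c} G-star = *-cancelˡ-≡ _ _ 2 (begin
  2 * (σ₁ G + σ₁ (complement G))              ≡⟨ ∑ₛ-contribution G ⟨
  ∑ₛ (λ S → 2 * contribution (#edges G S) (#edges (complement G) S))
    ≡⟨ ∑ₛ-cong (λ S → star-weight ∣ S ∣ _ _ (#edges-complement G S) (#edges-S S)) ⟨
  ∑ₛ (λ S → weight ∣ S ∣ (#edges G S))        ≡⟨ ∑ₛ-weight G ⟩
  2 * (n C 2) + #edges G ⊤ * ((n ∸ 2) C 1)    ≡⟨ cong (λ e → 2 * (n C 2) + e * ((n ∸ 2) C 1)) #edges-⊤ ⟩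
  2 * (n C 2) + (n ∸ 1) * ((n ∸ 2) C 1)       ≡⟨ 2[n∸1]² n ⟩
  2 * (n ∸ 1) ^ 2                             ∎)
  where
  open ≡-Reasoning
  #edges-S : ∀ S → #edges G S ≡ 0 ⊎ suc (#edges G S) ≡ ∣ S ∣
  #edges-S S with lookup S c in c∈S
  ... | true  = inj₂ (star-#edges-∋ G G-star S c∈S)
  ... | false = inj₁ (star-#edges-∌ G G-star S c∈S)
  #edges-⊤ : #edges G ⊤ ≡ n ∸ 1
  #edges-⊤ = cong (_∸ 1) (trans (star-#edges-∋ G G-star ⊤ (lookup-replicate c inside)) (∣⊤∣≡n n))

theorem3 : ∀ (n : ℕ) .{{_ : NonZero n}} (T : Graph n) → IsTree T →
    (σ₁ T + σ₁ (complement T) ≥ (n ∸ 1) ^ 2) ×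
    ((σ₁ T + σ₁ (complement T) ≡ (n ∸ 1) ^ 2) ⇔ (T ≅ K 1 (n ∸ 1)))
theorem3 (suc m) T tree = tree-σ₁-≥ T tree , mk⇔
  (Equivalence.to (star⇔≅K T) ∘ tree-σ₁-tight⇒star T tree)
  (λ T≅K → let _ , T-star = Equivalence.from (star⇔≅K T) T≅K in star-σ₁ T T-star)
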